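{- Let $B$ be a symmetric matrix over a field of characteristic $2$, with $\operatorname{epr}(B)=\ell_1\ell_2\cdots\ell_n$. Suppose $\ell_k=\mathtt{N}$ with $k$ even. Then $\ell_j=\mathtt{N}$ for all $j\geq k$ (with $j\le n$).
   Context: For an $n\times n$ symmetric matrix $B$ over a field $\mathbb{F}$, the enhanced principal rank characteristic sequence (epr-sequence) is $\operatorname{epr}(B)=\ell_1\ell_2\cdots\ell_n$, where $\ell_k=\mathtt{A}$ if all principal minors of $B$ of order $k$ are nonzero, $\ell_k=\mathtt{S}$ if some but not all principal minors of order $k$ are nonzero, and $\ell_k=\mathtt{N}$ if all principal minors of order $k$ are zero. -}

module Defs where

open import Algebra.Bundles using (CommutativeRing; Semiring)
import Algebra.Definitions.RawSemiring as RawSemiringOps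
open import Data.Fin.Base using (Fin; zero; suc; toℕ; punchIn)
open import Data.Fin.Subset using (Subset; inside; outside; ∣_∣)
open import Data.Nat.Base using (ℕ; zero; suc)
open import Data.Nat.Divisibility using () renaming (_∣_ to _divides_)
open import Data.Product.Base using (∃-syntax) renaming (_×_ to _∧_)
open import Data.Vec.Base using (Vec; _∷_; lookup)
open import Data.Vec.Functional using (Vector)
open import Function.Bundles using (_⇔_)
open import Level using (_⊔_) renaming (suc to lsuc)
open import Relation.Binary.PropositionalEquality.Core using (_≡_)
open import Relation.Nullary.Negation using (¬_)

-- The textbook notion of a field: equality need not be decidable and there is
-- no apartness relation (compare the library's HeytingField); "nonzero" means
-- ¬ (x ≈ 0#).
record Field c ℓ : Set (lsuc (c ⊔ ℓ)) where
  field
    commutativeRing : CommutativeRing c ℓ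

  open CommutativeRing commutativeRing public

  field
    1≉0     : ¬ (1# ≈ 0#)
    inverse : ∀ x → ¬ (x ≈ 0#) → ∃[ y ] x * y ≈ 1#

-- The k-th element, in increasing order, of a set of indices.
element : ∀ {n} (α : Subset n) → Fin ∣ α ∣ → Fin n
element (inside  ∷ α) zero    = zero
element (inside  ∷ α) (suc i) = suc (element α i)
element (outside ∷ α) i       = suc (element α i)

data Letter : Set where
  A S N : Letter

module _ {c ℓ} (F : Field c ℓ) where

  open Field F using (Carrier; _≈_; _*_; -_; 0#; 1#; semiring)
  open RawSemiringOps (Semiring.rawSemiring semiring) using (_×_; _^_; sum)

  -- The natural numbers m with m · 1 = 0 are exactly the multiples of p.
  HasCharacteristic : ℕ → Set ℓ
  HasCharacteristic p = ∀ m → (m × 1# ≈ 0#) ⇔ (p divides m)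

  SquareMatrix : ℕ → Set c
  SquareMatrix n = Vector (Vector Carrier n) n

  Symmetric : ∀ {n} → SquareMatrix n → Set ℓ
  Symmetric B = ∀ i j → B i j ≈ B j i

  -- Laplace expansion along the first row; the empty determinant is 1.
  det : ∀ {n} → SquareMatrix n → Carrier
  det {zero}  M = 1#
  det {suc n} M = sum λ j →
    (- 1#) ^ toℕ j * (M zero j * det (λ r s → M (suc r) (punchIn j s)))

  principalMinor : ∀ {n} → SquareMatrix n → Subset n → Carrier
  principalMinor B α = det (λ r s → B (element α r) (element α s))

  HasLetter : ∀ {n} → SquareMatrix n → ℕ → Letter → Set ℓ
  HasLetter B k A = ∀ α → ∣ α ∣ ≡ k → ¬ (principalMinor B α ≈ 0#)
  HasLetter B k S = (∃[ α ] ∣ α ∣ ≡ k ∧ ¬ (principalMinor B α ≈ 0#))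
                  ∧ ¬ (∀ α → ∣ α ∣ ≡ k → ¬ (principalMinor B α ≈ 0#))
  HasLetter B k N = ∀ α → ∣ α ∣ ≡ k → principalMinor B α ≈ 0#

  -- IsEpr B w says epr(B) = w.  Position i : Fin n of w, counted from 0, holds
  -- the letter of order suc (toℕ i).  For 1 ≤ k ≤ n at most one of the three
  -- letters applies, so w is determined by B; it is a relation and not a
  -- function because computing the letters would require deciding _≈_.
  IsEpr : ∀ {n} → SquareMatrix n → Vec Letter n → Set ℓ
  IsEpr B w = ∀ i → HasLetter B (suc (toℕ i)) (lookup w i)

{-# OPTIONS --safe #-}
module Submission where

-- In characteristic 2 the determinant is the permanent.  Let B be symmetric
-- with determinant D and cofactors c p q, so that c p q = c q p.
--
-- Odd order: adding up the expansions D = Σ_q B p q * c p q over all rows p,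
-- the off-diagonal terms cancel in pairs and D = Σ_p B p p * c p p.  Hence D
-- vanishes if all principal minors of order one less do.
--
-- Even order: if all principal minors E p q obtained by deleting rows and
-- columns p ≠ q vanish, then each c p p vanishes by the odd case, and Cramer's
-- rule for B without row q and column p gives c p q ² = E p q * D = 0.
-- As D is a linear combination of the c p q, also D ² = 0.
--
-- So, for even k, the letter N at k forces N at k + 1 and at k + 2.

open import Algebra.Bundles using (CommutativeRing; CommutativeSemiring; Semiring)
import Algebra.Definitions.RawSemiring as RawSemiringOps
import Algebra.Properties.CommutativeSemigroup as CommutativeSemigroupProperties
import Algebra.Properties.Ring as RingProperties
import Algebra.Properties.Semiring.Sum as SemiringSum
open import Data.Fin.Base using (Fin; zero; suc; toℕ; _≤_; punchIn; pinch)
open import Data.Fin.Properties using (sequence)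
import Data.Fin.Subset as Subset
open Subset using (Subset; inside; outside; ∣_∣)
open import Data.Fin.Subset.Properties using (∣⊥∣≡0)
open import Data.Nat.Base using (ℕ; zero; suc; _+_; _*_; _∸_; s≤s) renaming (_≤_ to _≤ℕ_)
open import Data.Nat.Divisibility using (_∣_; divides; ∣-refl)
open import Data.Nat.Properties using (+-suc; m∸n+n≡m)
open import Data.Product.Base using (∃-syntax; _,_)
open import Data.Vec.Base using (Vec; []; _∷_; lookup)
open import Effect.Monad using (RawMonad)
open import Function.Base using (_∘_; _$_)
open import Function.Bundles using (Equivalence)
open import Relation.Binary.PropositionalEquality.Core as ≡ using (_≡_)
import Relation.Binary.Reasoning.Setoid as SetoidReasoning
open import Relation.Nullary.Negation using (¬_; contradiction; ¬¬-map; ¬¬-Monad)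
open import Defs

-- Exchanging two distinct indices.

-- `pinch u i` is the position of `i` once `punchIn i u` is removed, so the two distinct indices can
-- trade roles.
punchIn-pinch : ∀ {n} (i : Fin (suc n)) (u : Fin n) →
                punchIn (punchIn i u) (pinch u i) ≡ i
punchIn-pinch {suc n} zero    u       = ≡.refl
punchIn-pinch {suc n} (suc i) zero    = ≡.refl
punchIn-pinch {suc n} (suc i) (suc u) = ≡.cong suc (punchIn-pinch i u)

-- Identifies minors of minors: two indices may be deleted in either order.
punchIn-comm : ∀ {n} (i : Fin (suc (suc n))) (u : Fin (suc n)) (t : Fin n) →
               punchIn (punchIn i u) (punchIn (pinch u i) t) ≡ punchIn i (punchIn u t)
punchIn-comm zero    u       t       = ≡.refl
punchIn-comm (suc i) zero    t       = ≡.refl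
punchIn-comm (suc i) (suc u) zero    = ≡.refl
punchIn-comm (suc i) (suc u) (suc t) = ≡.cong suc (punchIn-comm i u t)

-- Finite sums and permanents over a commutative semiring.

module Permanent {c ℓ} (R : CommutativeSemiring c ℓ) where

  open CommutativeSemiring R hiding (zero)
    renaming (_+_ to _⊕_; _*_ to _·_)
  open SemiringSum semiring using (sum; sum-cong-≋; sum-remove; sum-replicate-zero;
    ∑-distrib-+; *-distribˡ-sum)
    renaming (∑-comm to sum-comm)
  open CommutativeSemigroupProperties *-commutativeSemigroup
    using () renaming (x∙yz≈y∙xz to x·yz≈y·xz; interchange to ·-interchange)
  open SetoidReasoning setoid

  -- Opaque, because sum over Fin (suc n) unfolds to an addition and then its
  -- summand can no longer be inferred.
  opaque
    ∑ : ∀ {n} → (Fin n → Carrier) → Carrier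
    ∑ = sum

    ∑≈sum : ∀ {n} {f : Fin n → Carrier} → ∑ f ≈ sum f
    ∑≈sum = refl

    ∑-empty : {f : Fin 0 → Carrier} → ∑ f ≈ 0#
    ∑-empty = refl

    ∑-suc : ∀ {n} (f : Fin (suc n) → Carrier) → ∑ f ≈ f zero ⊕ ∑ (λ i → f (suc i))
    ∑-suc f = refl

    ∑-cong : ∀ {n} {f g : Fin n → Carrier} → (∀ i → f i ≈ g i) → ∑ f ≈ ∑ g
    ∑-cong = sum-cong-≋

    ∑-zero : ∀ {n} {f : Fin n → Carrier} → (∀ i → f i ≈ 0#) → ∑ f ≈ 0#
    ∑-zero {n} f≈0 = trans (sum-cong-≋ f≈0) (sum-replicate-zero n)

    ∑-remove : ∀ {n} (i : Fin (suc n)) (f : Fin (suc n) → Carrier) →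
               ∑ f ≈ f i ⊕ ∑ (λ u → f (punchIn i u))
    ∑-remove i f = sum-remove f

    ∑-+ : ∀ {n} (f g : Fin n → Carrier) → ∑ (λ i → f i ⊕ g i) ≈ ∑ f ⊕ ∑ g
    ∑-+ = ∑-distrib-+

    ∑-comm : ∀ {m n} (f : Fin m → Fin n → Carrier) →
             ∑ (λ i → ∑ (λ j → f i j)) ≈ ∑ (λ j → ∑ (λ i → f i j))
    ∑-comm = sum-comm

    *-distribˡ-∑ : ∀ {n} x (f : Fin n → Carrier) → x · ∑ f ≈ ∑ (λ i → x · f i)
    *-distribˡ-∑ = *-distribˡ-sum

  Matrix : ℕ → Set c
  Matrix n = Fin n → Fin n → Carrier

  minor : ∀ {n} → Matrix (suc n) → Fin (suc n) → Fin (suc n) → Matrix n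
  minor M i j r s = M (punchIn i r) (punchIn j s)

  per : ∀ {n} → Matrix n → Carrier
  per {zero}  M = 1#
  per {suc n} M = ∑ λ j → M zero j · per (minor M zero j)

  cofactor : ∀ {n} → Matrix (suc n) → Fin (suc n) → Fin (suc n) → Carrier
  cofactor M i j = per (minor M i j)

  per-cong : ∀ {n} {M N : Matrix n} → (∀ i j → M i j ≈ N i j) → per M ≈ per N
  per-cong {zero}  M≈N = refl
  per-cong {suc n} M≈N = ∑-cong λ j →
    *-cong (M≈N zero j) (per-cong λ r s → M≈N (suc r) (punchIn j s))

  ∑-single : ∀ {n} {f : Fin (suc n) → Carrier} i →
             (∀ u → f (punchIn i u) ≈ 0#) → ∑ f ≈ f i
  ∑-single {f = f} i f≈0 = begin
    ∑ f                               ≈⟨ ∑-remove i f ⟩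
    f i ⊕ ∑ (λ u → f (punchIn i u))   ≈⟨ +-congˡ (∑-zero f≈0) ⟩
    f i ⊕ 0#                          ≈⟨ +-identityʳ _ ⟩
    f i                               ∎

  ∑-omit : ∀ {n} {f : Fin (suc n) → Carrier} i →
           f i ≈ 0# → ∑ (λ u → f (punchIn i u)) ≈ ∑ f
  ∑-omit {f = f} i fi≈0 = sym $ begin
    ∑ f                               ≈⟨ ∑-remove i f ⟩
    f i ⊕ ∑ (λ u → f (punchIn i u))   ≈⟨ +-congʳ fi≈0 ⟩
    0# ⊕ ∑ (λ u → f (punchIn i u))    ≈⟨ +-identityˡ _ ⟩
    ∑ (λ u → f (punchIn i u))         ∎

  -- With `(i , u)` read as the indices `i` and `punchIn i u`, the three classes are: first index
  -- zero, second index zero, neither zero. The last is the same situation one size smaller, which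
  -- drives the inductions.
  ∑-distinct-split : ∀ {n} (f : Fin (suc (suc n)) → Fin (suc n) → Carrier) →
    ∑ (λ i → ∑ (f i)) ≈
      (∑ (f zero) ⊕ ∑ (λ i → f (suc i) zero)) ⊕ ∑ (λ i → ∑ λ u → f (suc i) (suc u))
  ∑-distinct-split f = begin
    ∑ (λ i → ∑ (f i))
      ≈⟨ ∑-suc _ ⟩
    ∑ (f zero) ⊕ ∑ (λ i → ∑ (f (suc i)))
      ≈⟨ +-congˡ (trans (∑-cong λ i → ∑-suc (f (suc i))) (∑-+ _ _)) ⟩
    ∑ (f zero) ⊕ (∑ (λ i → f (suc i) zero) ⊕ ∑ (λ i → ∑ λ u → f (suc i) (suc u)))
      ≈⟨ sym (+-assoc _ _ _) ⟩
    (∑ (f zero) ⊕ ∑ (λ i → f (suc i) zero)) ⊕ ∑ (λ i → ∑ λ u → f (suc i) (suc u)) ∎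

  -- A pair (i , u) stands for the ordered pair of distinct indices
  -- (i , punchIn i u); the right-hand side exchanges the two.
  ∑-distinct-swap : ∀ {n} (f : Fin (suc n) → Fin n → Carrier) →
    ∑ (λ i → ∑ (f i)) ≈ ∑ (λ i → ∑ λ u → f (punchIn i u) (pinch u i))
  ∑-distinct-swap {zero}  f = ∑-cong λ _ → trans ∑-empty (sym ∑-empty)
  ∑-distinct-swap {suc n} f = begin
    ∑ (λ i → ∑ (f i))
      ≈⟨ ∑-distinct-split f ⟩
    (∑ (f zero) ⊕ ∑ (λ i → f (suc i) zero)) ⊕ ∑ (λ i → ∑ λ u → f (suc i) (suc u))
      ≈⟨ +-cong (+-comm _ _) (∑-distinct-swap λ i u → f (suc i) (suc u)) ⟩
    (∑ (λ i → f (suc i) zero) ⊕ ∑ (f zero))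
      ⊕ ∑ (λ i → ∑ λ u → f (suc (punchIn i u)) (suc (pinch u i)))
      ≈⟨ sym (∑-distinct-split λ i u → f (punchIn i u) (pinch u i)) ⟩
    ∑ (λ i → ∑ λ u → f (punchIn i u) (pinch u i)) ∎

  -- Laplace expansions along rows and columns.

  -- Expanding along the first row and then, by induction, along row `i` of each minor gives a sum
  -- over ordered pairs of distinct columns. Exchanging the two columns turns it into the expansion
  -- that starts with row `suc i`.
  expand-row : ∀ {n} (M : Matrix (suc n)) i →
               per M ≈ ∑ (λ j → M i j · cofactor M i j)
  expand-row M zero = refl
  expand-row {suc n} M (suc i) = begin
    ∑ (λ j → M zero j · cofactor M zero j)
      ≈⟨ ∑-cong (λ j → trans
           (*-congˡ (expand-row (minor M zero j) i))
           (*-distribˡ-∑ _ _)) ⟩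
    ∑ (λ j → ∑ λ u → M zero j · (M (suc i) (punchIn j u) · cofactor (minor M zero j) i u))
      ≈⟨ ∑-cong (λ j → ∑-cong (λ u → trans
           (x·yz≈y·xz _ _ _)
           (*-congˡ (*-cong
             (reflexive (≡.cong (M zero) (≡.sym (punchIn-pinch j u))))
             (per-cong λ r t → reflexive
               (≡.cong (M (suc (punchIn i r))) (≡.sym (punchIn-comm j u t)))))))) ⟩
    ∑ (λ j → ∑ λ u → term (punchIn j u) (pinch u j))
      ≈⟨ sym (∑-distinct-swap term) ⟩
    ∑ (λ j → ∑ (term j))
      ≈⟨ ∑-cong (λ j → sym (*-distribˡ-∑ _ _)) ⟩
    ∑ (λ j → M (suc i) j · cofactor M (suc i) j) ∎
    where
    term : Fin (suc (suc n)) → Fin (suc n) → Carrier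
    term j u = M (suc i) j · (M zero (punchIn j u) · cofactor (minor M (suc i) j) zero u)

  -- The corner term is common to both expansions. In the rest, the cofactors on the left are
  -- expanded along their first column by induction, those on the right along their first row by
  -- definition, and the double sums agree.
  expand-column₀ : ∀ {n} (M : Matrix (suc n)) →
                   per M ≈ ∑ (λ i → M i zero · cofactor M i zero)
  expand-column₀ {zero}  M = ∑-cong λ { zero → refl }
  expand-column₀ {suc n} M = trans (∑-suc _) (trans (+-congˡ rests) (sym (∑-suc _)))
    where
    rest : Fin (suc n) → Fin (suc n) → Carrier
    rest i j = per λ r s → M (suc (punchIn i r)) (suc (punchIn j s))

    rests : ∑ (λ j → M zero (suc j) · cofactor M zero (suc j)) ≈
            ∑ (λ i → M (suc i) zero · cofactor M (suc i) zero)
    rests = begin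
      ∑ (λ j → M zero (suc j) · cofactor M zero (suc j))
        ≈⟨ ∑-cong (λ j → trans
             (*-congˡ (expand-column₀ (minor M zero (suc j))))
             (*-distribˡ-∑ _ _)) ⟩
      ∑ (λ j → ∑ λ i → M zero (suc j) · (M (suc i) zero · rest i j))
        ≈⟨ ∑-comm _ ⟩
      ∑ (λ i → ∑ λ j → M zero (suc j) · (M (suc i) zero · rest i j))
        ≈⟨ ∑-cong (λ i → trans
             (∑-cong λ j → x·yz≈y·xz _ _ _)
             (sym (*-distribˡ-∑ _ _))) ⟩
      ∑ (λ i → M (suc i) zero · cofactor M (suc i) zero) ∎

  per-transpose : ∀ {n} (M : Matrix n) → per (λ i j → M j i) ≈ per M
  per-transpose {zero}  M = refl
  per-transpose {suc n} M = trans
    (∑-cong λ j → *-congˡ (per-transpose (minor M j zero)))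
    (sym (expand-column₀ M))

  expand-column : ∀ {n} (M : Matrix (suc n)) j →
                  per M ≈ ∑ (λ i → M i j · cofactor M i j)
  expand-column M j = begin
    per M                ≈⟨ sym (per-transpose M) ⟩
    per (λ r s → M s r)  ≈⟨ expand-row (λ r s → M s r) j ⟩
    ∑ (λ i → M i j · cofactor (λ r s → M s r) j i)
      ≈⟨ ∑-cong (λ i → *-congˡ (per-transpose (minor M i j))) ⟩
    ∑ (λ i → M i j · cofactor M i j) ∎

  cofactor-sym : ∀ {n} {M : Matrix (suc n)} → (∀ i j → M i j ≈ M j i) →
                 ∀ i j → cofactor M i j ≈ cofactor M j i
  cofactor-sym {M = M} M-sym i j = trans
    (sym (per-transpose (minor M i j)))
    (per-cong λ r s → M-sym (punchIn i s) (punchIn j r))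

  -- Cancellation and cofactor identities in characteristic 2.

  module Characteristic2 (x+x≈0 : ∀ x → x ⊕ x ≈ 0#) where

    -- The two orderings of a pair contribute equal terms, which cancel.
    ∑-distinct-symmetric : ∀ {n} (f : Fin (suc n) → Fin n → Carrier) →
      (∀ i u → f i u ≈ f (punchIn i u) (pinch u i)) →
      ∑ (λ i → ∑ (f i)) ≈ 0#
    ∑-distinct-symmetric {zero}  f f-sym = ∑-zero λ _ → ∑-empty
    ∑-distinct-symmetric {suc n} f f-sym = begin
      ∑ (λ i → ∑ (f i))
        ≈⟨ ∑-distinct-split f ⟩
      (∑ (f zero) ⊕ ∑ (λ i → f (suc i) zero)) ⊕ ∑ (λ i → ∑ λ u → f (suc i) (suc u))
        ≈⟨ +-cong (+-congʳ (∑-cong (f-sym zero)))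
             (∑-distinct-symmetric _ λ i u → f-sym (suc i) (suc u)) ⟩
      (∑ (λ i → f (suc i) zero) ⊕ ∑ (λ i → f (suc i) zero)) ⊕ 0#
        ≈⟨ trans (+-identityʳ _) (x+x≈0 _) ⟩
      0# ∎

    ∑-symmetric : ∀ {n} (g : Matrix n) → (∀ i j → g i j ≈ g j i) →
      ∑ (λ i → ∑ (g i)) ≈ ∑ (λ i → g i i)
    ∑-symmetric {zero}  g g-sym = trans ∑-empty (sym ∑-empty)
    ∑-symmetric {suc n} g g-sym = begin
      ∑ (λ i → ∑ (g i))
        ≈⟨ ∑-cong (λ i → ∑-remove i (g i)) ⟩
      ∑ (λ i → g i i ⊕ ∑ (λ u → g i (punchIn i u)))
        ≈⟨ ∑-+ (λ i → g i i) _ ⟩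
      ∑ (λ i → g i i) ⊕ ∑ (λ i → ∑ (λ u → g i (punchIn i u)))
        ≈⟨ +-congˡ (∑-distinct-symmetric (λ i u → g i (punchIn i u)) λ i u → trans
             (g-sym i (punchIn i u))
             (reflexive (≡.cong (g (punchIn i u)) (≡.sym (punchIn-pinch i u))))) ⟩
      ∑ (λ i → g i i) ⊕ 0#
        ≈⟨ +-identityʳ _ ⟩
      ∑ (λ i → g i i) ∎

    -- Squaring is additive here, since the cross terms cancel.
    ∑-square-zero : ∀ {n} (f : Fin n → Carrier) →
      (∀ i → f i · f i ≈ 0#) → ∑ f · ∑ f ≈ 0#
    ∑-square-zero {zero}  f f²≈0 = trans (*-congˡ ∑-empty) (zeroʳ _)
    ∑-square-zero {suc n} f f²≈0 = begin
      ∑ f · ∑ f                             ≈⟨ *-cong (∑-suc f) (∑-suc f) ⟩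
      (a ⊕ b) · (a ⊕ b)                     ≈⟨ distribʳ _ _ _ ⟩
      a · (a ⊕ b) ⊕ b · (a ⊕ b)             ≈⟨ +-cong (distribˡ _ _ _) (distribˡ _ _ _) ⟩
      (a · a ⊕ a · b) ⊕ (b · a ⊕ b · b)     ≈⟨ +-cong (+-congʳ (f²≈0 zero))
                                                 (+-congˡ (∑-square-zero (f ∘ suc) (f²≈0 ∘ suc))) ⟩
      (0# ⊕ a · b) ⊕ (b · a ⊕ 0#)           ≈⟨ +-cong (+-identityˡ _) (+-identityʳ _) ⟩
      a · b ⊕ b · a                         ≈⟨ +-congˡ (*-comm b a) ⟩
      a · b ⊕ a · b                         ≈⟨ x+x≈0 _ ⟩
      0#                                    ∎
      where
      a = f zero
      b = ∑ (f ∘ suc)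

    -- This is the permanent of `M` with row `i` replaced by a copy of another row. Expanding along
    -- both equal rows gives a sum symmetric in the two columns.
    expand-alien-row : ∀ {n} (M : Matrix (suc n)) i u →
      ∑ (λ j → M (punchIn i u) j · cofactor M i j) ≈ 0#
    expand-alien-row {suc n} M i u = begin
      ∑ (λ j → x j · cofactor M i j)
        ≈⟨ ∑-cong (λ j → trans
             (*-congˡ (expand-row (minor M i j) u))
             (*-distribˡ-∑ _ _)) ⟩
      ∑ (λ j → ∑ (term j))
        ≈⟨ ∑-distinct-symmetric term (λ j v → trans
             (x·yz≈y·xz _ _ _)
             (*-congˡ (*-cong
               (reflexive (≡.cong x (≡.sym (punchIn-pinch j v))))
               (per-cong λ r t → reflexive
                 (≡.cong (M (punchIn i (punchIn u r))) (≡.sym (punchIn-comm j v t))))))) ⟩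
      0# ∎
      where
      x : Fin (suc (suc n)) → Carrier
      x = M (punchIn i u)
      term : Fin (suc (suc n)) → Fin (suc n) → Carrier
      term j v = x j · (x (punchIn j v) · cofactor (minor M i j) u v)

    expand-alien-column : ∀ {n} (M : Matrix (suc n)) j u →
      ∑ (λ i → M i (punchIn j u) · cofactor M i j) ≈ 0#
    expand-alien-column M j u = trans
      (∑-cong λ i → *-congˡ (sym (per-transpose (minor M i j))))
      (expand-alien-row (λ r s → M s r) j u)

    -- Unsigned cofactors form the adjugate in characteristic 2. After the sums are exchanged, the
    -- coefficient of `v s` is an alien column expansion unless `s` is `j`.
    cramer : ∀ {n} (M : Matrix (suc n)) (v : Fin (suc n) → Carrier) j →
      ∑ (λ i → cofactor M i j · ∑ (λ s → M i s · v s)) ≈ v j · per M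
    cramer M v j = begin
      ∑ (λ i → cofactor M i j · ∑ (λ s → M i s · v s))
        ≈⟨ ∑-cong (λ i → trans
             (*-distribˡ-∑ _ _)
             (∑-cong λ s → trans
               (trans (sym (*-assoc _ _ _)) (*-comm _ _))
               (*-congˡ (*-comm (cofactor M i j) (M i s))))) ⟩
      ∑ (λ i → ∑ λ s → v s · (M i s · cofactor M i j))
        ≈⟨ ∑-comm (λ i s → v s · (M i s · cofactor M i j)) ⟩
      ∑ (λ s → ∑ λ i → v s · (M i s · cofactor M i j))
        ≈⟨ ∑-cong (λ s → sym (*-distribˡ-∑ _ _)) ⟩
      ∑ (λ s → v s · ∑ (λ i → M i s · cofactor M i j))
        ≈⟨ ∑-single j (λ u → trans (*-congˡ (expand-alien-column M j u)) (zeroʳ _)) ⟩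
      v j · ∑ (λ i → M i j · cofactor M i j)
        ≈⟨ *-congˡ (sym (expand-column M j)) ⟩
      v j · per M ∎

    -- Row `p` of the cofactors is sent by `M` to `per M` times the unit vector at `p`. Its entry at
    -- `p` vanishes, so the remaining entries `v` solve a system with matrix `M′`, to which Cramer's
    -- rule applies; by symmetry `per M′` is itself `v u`.
    cofactor-square : ∀ {n} {M : Matrix (suc (suc n))} → (∀ i j → M i j ≈ M j i) →
      ∀ p u → cofactor M p p ≈ 0# →
      cofactor M p (punchIn p u) · cofactor M p (punchIn p u)
        ≈ cofactor (minor M p p) u u · per M
    cofactor-square {n} {M} M-sym p u cₚₚ≈0 = begin
      v u · v u
        ≈⟨ *-congˡ (cofactor-sym M-sym p q) ⟩
      v u · per M′
        ≈⟨ sym (cramer M′ v u) ⟩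
      ∑ (λ i → cofactor M′ i u · ∑ (λ s → M′ i s · v s))
        ≈⟨ ∑-cong (λ i → *-congˡ (∑-omit p (trans (*-congˡ cₚₚ≈0) (zeroʳ _)))) ⟩
      ∑ (λ i → cofactor M′ i u · row (punchIn q i))
        -- Row `p` of `M` sits at position `pinch u p` in `M′`; all other rows give alien
        -- expansions.
        ≈⟨ ∑-single (pinch u p) (λ t → trans (*-congˡ (other-rows t)) (zeroʳ _)) ⟩
      cofactor M′ (pinch u p) u · row (punchIn q (pinch u p))
        ≈⟨ *-cong
             (per-cong λ r s → reflexive
               (≡.cong (λ i → M i (punchIn p (punchIn u s))) (punchIn-comm p u r)))
             (trans (reflexive (≡.cong row (punchIn-pinch p u))) (sym (expand-row M p))) ⟩
      cofactor (minor M p p) u u · per M ∎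
      where
      q : Fin (suc (suc n))
      q = punchIn p u

      M′ : Matrix (suc n)
      M′ = minor M q p

      v : Fin (suc n) → Carrier
      v s = cofactor M p (punchIn p s)

      row : Fin (suc (suc n)) → Carrier
      row i = ∑ λ s → M i s · cofactor M p s

      other-rows : ∀ t → row (punchIn q (punchIn (pinch u p) t)) ≈ 0#
      other-rows t = trans
        (reflexive (≡.cong row (punchIn-comm p u t)))
        (expand-alien-row M p (punchIn u t))

    -- Symmetric matrices of odd and even order.

    ∑-const-even : ∀ m x → ∑ {m * 2} (λ _ → x) ≈ 0#
    ∑-const-even zero    x = ∑-empty
    ∑-const-even (suc m) x = begin
      ∑ (λ _ → x)                      ≈⟨ trans (∑-suc _) (+-congˡ (∑-suc _)) ⟩
      x ⊕ (x ⊕ ∑ {m * 2} (λ _ → x))    ≈⟨ sym (+-assoc _ _ _) ⟩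
      (x ⊕ x) ⊕ ∑ {m * 2} (λ _ → x)    ≈⟨ +-cong (x+x≈0 x) (∑-const-even m x) ⟩
      0# ⊕ 0#                          ≈⟨ +-identityˡ 0# ⟩
      0#                               ∎

    per-odd : ∀ m {M : Matrix (suc (m * 2))} → (∀ i j → M i j ≈ M j i) →
      (∀ i → cofactor M i i ≈ 0#) → per M ≈ 0#
    per-odd m {M} M-sym cᵢᵢ≈0 = begin
      per M
        ≈⟨ sym (+-identityʳ _) ⟩
      per M ⊕ 0#
        -- An odd number of copies of `per M` adds up to `per M`, so every row can be expanded once.
        ≈⟨ trans (+-congˡ (sym (∑-const-even m (per M)))) (sym (∑-suc _)) ⟩
      ∑ {suc (m * 2)} (λ _ → per M)
        ≈⟨ ∑-cong (expand-row M) ⟩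
      ∑ (λ i → ∑ λ j → M i j · cofactor M i j)
        ≈⟨ ∑-symmetric _ (λ i j → *-cong (M-sym i j) (cofactor-sym M-sym i j)) ⟩
      ∑ (λ i → M i i · cofactor M i i)
        ≈⟨ ∑-zero (λ i → trans (*-congˡ (cᵢᵢ≈0 i)) (zeroʳ _)) ⟩
      0# ∎

    -- Only the square is reached, because `R` may have nonzero elements of square zero;
    -- `square-zero` deals with this over a field.
    per-even : ∀ m {M : Matrix (suc (suc (m * 2)))} → (∀ i j → M i j ≈ M j i) →
      (∀ i u → cofactor (minor M i i) u u ≈ 0#) → per M · per M ≈ 0#
    per-even m {M} M-sym E≈0 = ∑-square-zero (λ j → M zero j · cofactor M zero j) λ j →
      trans (·-interchange _ _ _ _) (trans (*-congˡ (c²≈0 j)) (zeroʳ _))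
      where
      c₀₀≈0 : cofactor M zero zero ≈ 0#
      -- The minor at the corner is symmetric of odd order, and its own diagonal cofactors are among
      -- those assumed zero.
      c₀₀≈0 = per-odd m (λ i j → M-sym (suc i) (suc j)) (E≈0 zero)

      c²≈0 : ∀ j → cofactor M zero j · cofactor M zero j ≈ 0#
      c²≈0 zero    = trans (*-congʳ c₀₀≈0) (zeroˡ _)
      c²≈0 (suc u) = trans (cofactor-square M-sym zero u c₀₀≈0)
        (trans (*-congʳ (E≈0 zero u)) (zeroˡ _))

-- Increasing enumerations of index subsets.

-- A relation, so that the domain Fin m of f need only match ∣ α ∣ up to a proof.
data Enumerates : ∀ {m n} → Subset n → (Fin m → Fin n) → Set where
  []   : {f : Fin 0 → Fin 0} → Enumerates [] f
  skip : ∀ {m n} {α : Subset n} {f : Fin m → Fin n} {g : Fin m → Fin (suc n)} →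
         Enumerates α f → (∀ i → g i ≡ suc (f i)) → Enumerates (outside ∷ α) g
  take : ∀ {m n} {α : Subset n} {f : Fin m → Fin n} {g : Fin (suc m) → Fin (suc n)} →
         Enumerates α f → g zero ≡ zero → (∀ i → g (suc i) ≡ suc (f i)) →
         Enumerates (inside ∷ α) g

element-enumerates : ∀ {n} (α : Subset n) → Enumerates α (element α)
element-enumerates []            = []
element-enumerates (inside ∷ α)  = take (element-enumerates α) ≡.refl λ _ → ≡.refl
element-enumerates (outside ∷ α) = skip (element-enumerates α) λ _ → ≡.refl

enumerates-size : ∀ {m n} {α : Subset n} {f : Fin m → Fin n} →
                  Enumerates α f → ∣ α ∣ ≡ m
enumerates-size []           = ≡.refl
enumerates-size (skip e _)   = enumerates-size e
enumerates-size (take e _ _) = ≡.cong suc (enumerates-size e)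

enumerates-element : ∀ {n} (α : Subset n) {f : Fin ∣ α ∣ → Fin n} →
                     Enumerates α f → ∀ i → f i ≡ element α i
enumerates-element (inside ∷ α)  (take e g₀ gₛ) zero    = g₀
enumerates-element (inside ∷ α)  (take e g₀ gₛ) (suc i) =
  ≡.trans (gₛ i) (≡.cong suc (enumerates-element α e i))
enumerates-element (outside ∷ α) (skip e g≡)    i       =
  ≡.trans (g≡ i) (≡.cong suc (enumerates-element α e i))

-- Ensures that deleting row and column `i` from a principal submatrix leaves a principal submatrix
-- of the same ambient matrix.
enumerates-remove : ∀ {m n} {α : Subset n} {f : Fin (suc m) → Fin n} →
  Enumerates α f → ∀ i → ∃[ β ] Enumerates β (f ∘ punchIn i)
enumerates-remove (skip e g≡) i with enumerates-remove e i
... | β , e′ = outside ∷ β , skip e′ (g≡ ∘ punchIn i)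
enumerates-remove {α = _ ∷ α} (take e g₀ gₛ) zero = outside ∷ α , skip e gₛ
enumerates-remove {suc m} (take e g₀ gₛ) (suc i) with enumerates-remove e i
... | β , e′ = inside ∷ β , take e′ g₀ (gₛ ∘ punchIn i)

-- Excludes vacuity: the letter `A` conflicts with vanishing minors only if a minor of that order
-- exists.
subset-of-size : ∀ {n} (j : Fin n) → ∃[ α ] ∣_∣ {n} α ≡ suc (toℕ j)
subset-of-size {suc n} zero    = inside ∷ Subset.⊥ , ≡.cong suc (∣⊥∣≡0 n)
subset-of-size {suc n} (suc j) with subset-of-size j
... | α , ∣α∣≡ = inside ∷ α , ≡.cong suc ∣α∣≡

-- From permanents to principal minors over a field.

module _ {c ℓ} (F : Field c ℓ) (char2 : HasCharacteristic F 2) where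

  open Field F using (Carrier; _≈_; -_; 0#; 1#; commutativeRing; setoid; semiring;
    refl; sym; trans; reflexive; +-congˡ; +-cong; +-identityʳ; *-congˡ; *-congʳ; *-cong;
    *-identityˡ; *-identityʳ; *-assoc; zeroˡ; zeroʳ; distribˡ; ring; inverse)
    renaming (_+_ to _⊕_; _*_ to _·_)
  open RawSemiringOps (Semiring.rawSemiring semiring) using (_^_)
  open RingProperties ring using (+-inverseˡ-unique)
  open Permanent (CommutativeRing.commutativeSemiring commutativeRing)
  open SemiringSum semiring using (sum-cong-≋)
  open SetoidReasoning setoid

  1+1≈0 : 1# ⊕ 1# ≈ 0#
  1+1≈0 = trans (+-congˡ (sym (+-identityʳ 1#))) (Equivalence.from (char2 2) ∣-refl)

  x+x≈0 : ∀ x → x ⊕ x ≈ 0#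
  x+x≈0 x = begin
    x ⊕ x             ≈⟨ +-cong (sym (*-identityʳ x)) (sym (*-identityʳ x)) ⟩
    x · 1# ⊕ x · 1#   ≈⟨ sym (distribˡ x 1# 1#) ⟩
    x · (1# ⊕ 1#)     ≈⟨ *-congˡ 1+1≈0 ⟩
    x · 0#            ≈⟨ zeroʳ x ⟩
    0#                ∎

  open Characteristic2 x+x≈0

  -1^k≈1 : ∀ k → (- 1#) ^ k ≈ 1#
  -1^k≈1 zero    = refl
  -1^k≈1 (suc k) = trans
    (*-cong (sym (+-inverseˡ-unique 1# 1# 1+1≈0)) (-1^k≈1 k)) (*-identityˡ 1#)

  det≈per : ∀ {n} (M : SquareMatrix F n) → det F M ≈ per M
  det≈per {zero}  M = refl
  det≈per {suc n} M = trans
    (sum-cong-≋ λ j → trans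
      (*-cong (-1^k≈1 (toℕ j)) (*-congˡ (det≈per (minor M zero j))))
      (*-identityˡ (M zero j · cofactor M zero j)))
    (sym ∑≈sum)

  -- An inverse is available only for an element assumed nonzero, so what results is a refutation of
  -- that assumption.
  square-zero : ∀ {x} → x · x ≈ 0# → ¬ ¬ (x ≈ 0#)
  square-zero {x} x²≈0 x≉0 with inverse x x≉0
  ... | y , xy≈1 = x≉0 $ begin
    x              ≈⟨ sym (*-identityʳ x) ⟩
    x · 1#         ≈⟨ *-congˡ (sym xy≈1) ⟩
    x · (x · y)    ≈⟨ sym (*-assoc x x y) ⟩
    (x · x) · y    ≈⟨ *-congʳ x²≈0 ⟩
    0# · y         ≈⟨ zeroˡ y ⟩
    0#             ∎

  module _ {n} (B : SquareMatrix F n) (B-sym : Symmetric F B) where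

    submatrix : ∀ {m} → (Fin m → Fin n) → Matrix m
    submatrix f i j = B (f i) (f j)

    principalMinor≈per : ∀ α {m} {f : Fin m → Fin n} → Enumerates α f →
                         principalMinor F B α ≈ per (submatrix f)
    principalMinor≈per α e with enumerates-size e
    ... | ≡.refl = trans (det≈per (submatrix (element α)))
      (per-cong λ i j → reflexive (≡.sym
        (≡.cong₂ B (enumerates-element α e i) (enumerates-element α e j))))

    -- Equality need not be stable, so only the double negation propagates.
    Vanish : ℕ → Set ℓ
    Vanish m = ∀ {α} {f : Fin m → Fin n} → Enumerates α f → ¬ ¬ (per (submatrix f) ≈ 0#)

    vanish-suc : ∀ m → Vanish (m * 2) → Vanish (suc (m * 2))
    vanish-suc m V {f = f} e = ¬¬-map
      (per-odd m λ i j → B-sym (f i) (f j))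
      -- Double negation commutes with quantification over the finite type of indices.
      (sequence (RawMonad.rawApplicative ¬¬-Monad) λ i → let β , e′ = enumerates-remove e i in V e′)

    vanish-suc-suc : ∀ m → Vanish (m * 2) → Vanish (suc (suc (m * 2)))
    vanish-suc-suc m V {f = f} e per≉0 =
      sequence (RawMonad.rawApplicative ¬¬-Monad)
        (λ i → sequence (RawMonad.rawApplicative ¬¬-Monad) λ u →
          let β  , e′ = enumerates-remove e i
              β′ , e″ = enumerates-remove e′ u
          in V e″)
        λ E≈0 → square-zero (per-even m (λ i j → B-sym (f i) (f j)) E≈0) per≉0

    -- Advancing by two keeps the starting order even, as both step lemmas demand; an odd distance
    -- ends with a single `vanish-suc`.
    vanish-+ : ∀ d m → Vanish (m * 2) → Vanish (d + m * 2)
    vanish-+ zero          m V = V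
    vanish-+ (suc zero)    m V = vanish-suc m V
    vanish-+ (suc (suc d)) m V = ≡.subst Vanish
      (≡.trans (+-suc d _) (≡.cong suc (+-suc d _)))
      (vanish-+ d (suc m) (vanish-suc-suc m V))

    principalMinors-vanish : ∀ {k j} → 2 ∣ k → k ≤ℕ j → HasLetter F B k N →
      ∀ α → ∣ α ∣ ≡ j → ¬ ¬ (principalMinor F B α ≈ 0#)
    principalMinors-vanish {k} (divides m ≡.refl) k≤j Bₖ≈0 α ≡.refl = ¬¬-map
      (trans (principalMinor≈per α (element-enumerates α)))
      (≡.subst Vanish (m∸n+n≡m k≤j) (vanish-+ (∣ α ∣ ∸ k) m Vₖ) (element-enumerates α))
      where
      Vₖ : Vanish k
      Vₖ {β} e per≉0 =
        per≉0 (trans (sym (principalMinor≈per β e)) (Bₖ≈0 β (enumerates-size e)))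

mainTheorem5 : ∀ {c ℓ} (F : Field c ℓ) → HasCharacteristic F 2 →
    ∀ {n : ℕ} (B : SquareMatrix F n) → Symmetric F B →
    ∀ (w : Vec Letter n) → IsEpr F B w →
    ∀ (k : Fin n) → 2 ∣ suc (toℕ k) → lookup w k ≡ N →
    ∀ (j : Fin n) → k ≤ j → lookup w j ≡ N
mainTheorem5 F char2 B B-sym w epr k 2∣k wₖ≡N j k≤j = letter (lookup w j) (epr j)
  where
  vanish : ∀ α → ∣ α ∣ ≡ suc (toℕ j) → ¬ ¬ (Field._≈_ F (principalMinor F B α) (Field.0# F))
  vanish = principalMinors-vanish F char2 B B-sym 2∣k (s≤s k≤j)
    (≡.subst (HasLetter F B _) wₖ≡N (epr k))

  -- Refuting `A` and `S` leaves only `N`, and for a refutation the doubly negated vanishing is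
  -- enough.
  letter : ∀ l → HasLetter F B (suc (toℕ j)) l → l ≡ N
  letter A all≉0 with subset-of-size j
  ... | α , ∣α∣≡ = contradiction (all≉0 α ∣α∣≡) (vanish α ∣α∣≡)
  letter S ((α , ∣α∣≡ , α≉0) , _) = contradiction α≉0 (vanish α ∣α∣≡)
  letter N _ = ≡.refl
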